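{- Let $\sigma$ and $\tau$ be simple types. If $\sigma\trianglelefteq^1\tau$ is derivable in system CF, then $\sigma\trianglelefteq^1\tau$ is also derivable in system LPS. In particular, CF is sound for affine retractions: if $\sigma\trianglelefteq^1\tau$ is derivable in CF, then $\sigma$ is a retract of $\tau$ via an affine coder and an affine decoder.
   Context: Simple types are built from type variables (atoms) $a,b,c,\dots$ (many distinct atoms) with $\to$. If $\tau=\tau_1\to\cdots\to\tau_k\to a$ with $a$ an atom, then $head(\tau)=a$. Terms are simply typed $\lambda$-terms in Church style. Retraction: $\rho\trianglelefteq\tau$ means that there are a type environment $E$ and terms $C$ (the coder), $D$ (the decoder) with $E,(x:\rho)\vdash C:\tau$, $E\vdash D:\tau\to\rho$, $x\notin FV(D)$, and $DC=_{\beta\eta}x$. The types of the free variables declared in $E$ are arbitrary. A $\lambda$-term is affine (a BCK-term) if each variable occurs in it at most once. Semantically, $\rho\trianglelefteq^1\tau$ means that $\rho\trianglelefteq\tau$ holds with an affine coder $C$ and an affine decoder $D$. Isomorphism convention: $\sim$ is the least equivalence relation on simple types such that (1) $\tau\sim\tau'$ and $\sigma\sim\sigma'$ imply $(\tau\to\sigma)\sim(\tau'\to\sigma')$, and (2) $(\tau\to\sigma\to\rho)\sim(\sigma\to\tau\to\rho)$. Types related by $\sim$ are identified, in particular in derivations. For a finite multiset of types $\Sigma=\{\tau_1,\dots,\tau_k\}$, $\Sigma\to\rho$ denotes (any representative of the $\sim$-class of) $\tau_1\to\cdots\to\tau_k\to\rho$ (just $\rho$ if $\Sigma$ is empty). System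 CF derives statements $\rho\trianglelefteq^1\tau$ (types modulo $\sim$) from: (Axiom) $a\trianglelefteq^1 a$, for each atom $a$. (H) from $\sigma\trianglelefteq^1\sigma'$ and $\tau\trianglelefteq^1\tau'$ infer $\sigma\to\tau\trianglelefteq^1\sigma'\to\tau'$. (N) from $\rho\trianglelefteq^1\tau$ infer $\rho\trianglelefteq^1\Sigma\to\tau$. (D) from $\Delta_1\to a\trianglelefteq^1\sigma_1,\ \dots,\ \Delta_n\to a\trianglelefteq^1\sigma_n$ infer $\Delta_1\cup\dots\cup\Delta_n\to a\ \trianglelefteq^1\ \{\Sigma_1\to\sigma_1\to a,\dots,\Sigma_n\to\sigma_n\to a\}\to a$. Here $\Sigma,\Sigma_i,\Delta_i$ are arbitrary finite multisets of types, $\cup$ is multiset union, and $a$ is an atom. System LPS derives statements $\rho\trianglelefteq^1\tau$ (types modulo $\sim$) from: (A1) $\sigma\trianglelefteq^1\sigma$. (A2) $\sigma\trianglelefteq^1\tau\to\sigma$. (A4) $\sigma\trianglelefteq^1(\sigma\to a)\to a$, provided $head(\sigma)=a$ ($a$ an arbitrary atom). (R1) from $\sigma\trianglelefteq^1\tau$ and $\tau\trianglelefteq^1\rho$ infer $\sigma\trianglelefteq^1\rho$. (R2) from $\sigma\trianglelefteq^1\sigma'$ and $\tau\trianglelefteq^1\tau'$ infer $\sigma\to\tau\trianglelefteq^1\sigma'\to\tau'$. -}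

module Defs where

open import Data.Bool using (if_then_else_)
open import Data.Fin using (Fin; zero; suc; _≟_)
open import Data.List using (List; []; _∷_; foldr; concat; tabulate; length)
open import Data.List.Membership.Propositional using (_∈_)
open import Data.List.Relation.Binary.Subset.Propositional using (_⊆_)
open import Data.List.Relation.Binary.Subset.Propositional.Properties using (∷⁺ʳ)
open import Data.List.Relation.Unary.Any using (here; there; index)
open import Data.Nat using (ℕ; _+_; _≤_)
open import Data.Product using (Σ-syntax; _×_)
open import Data.Unit using (⊤)
open import Relation.Binary.PropositionalEquality using (_≡_; refl)
open import Relation.Nullary using (does)

Atom : Set
Atom = ℕ

infixr 7 _⇒_ _⇛_

data Ty : Set where
  `_  : Atom → Ty
  _⇒_ : Ty → Ty → Ty

head : Ty → Atom
head (` a)   = a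
head (σ ⇒ τ) = head τ

-- A finite multiset of types is given by a list enumerating it. The order is
-- immaterial: permuting Σ changes Σ ⇛ ρ only up to _∼_ below.
_⇛_ : List Ty → Ty → Ty
Σs ⇛ ρ = foldr _⇒_ ρ Σs

infix 4 _∼_

data _∼_ : Ty → Ty → Set where
  ∼-refl  : ∀ {σ} → σ ∼ σ
  ∼-sym   : ∀ {σ τ} → σ ∼ τ → τ ∼ σ
  ∼-trans : ∀ {σ τ ρ} → σ ∼ τ → τ ∼ ρ → σ ∼ ρ
  ∼-cong  : ∀ {τ τ′ σ σ′} → τ ∼ τ′ → σ ∼ σ′ → τ ⇒ σ ∼ τ′ ⇒ σ′
  ∼-swap  : ∀ {τ σ ρ} → τ ⇒ σ ⇒ ρ ∼ σ ⇒ τ ⇒ ρ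

-- Both systems derive statements about types modulo _∼_; since types are not
-- quotiented here, this identification is the rule `conv`.

infix 4 _⊴CF_ _⊴LPS_

data _⊴CF_ : Ty → Ty → Set where
  conv : ∀ {ρ ρ′ τ τ′} → ρ ∼ ρ′ → τ ∼ τ′ → ρ ⊴CF τ → ρ′ ⊴CF τ′
  Ax   : ∀ {a} → ` a ⊴CF ` a
  H    : ∀ {σ σ′ τ τ′} → σ ⊴CF σ′ → τ ⊴CF τ′ → σ ⇒ τ ⊴CF σ′ ⇒ τ′
  N    : ∀ {ρ τ} (Σs : List Ty) → ρ ⊴CF τ → ρ ⊴CF Σs ⇛ τ
  D    : ∀ {a} {n : ℕ} (Δ Σs : Fin n → List Ty) (σ : Fin n → Ty) →
         (∀ i → Δ i ⇛ ` a ⊴CF σ i) →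
         concat (tabulate Δ) ⇛ ` a
           ⊴CF tabulate (λ i → Σs i ⇛ (σ i ⇒ ` a)) ⇛ ` a

data _⊴LPS_ : Ty → Ty → Set where
  conv : ∀ {ρ ρ′ τ τ′} → ρ ∼ ρ′ → τ ∼ τ′ → ρ ⊴LPS τ → ρ′ ⊴LPS τ′
  A1   : ∀ {σ} → σ ⊴LPS σ
  A2   : ∀ {σ τ} → σ ⊴LPS τ ⇒ σ
  A4   : ∀ {σ a} → head σ ≡ a → σ ⊴LPS (σ ⇒ ` a) ⇒ ` a
  R1   : ∀ {σ τ ρ} → σ ⊴LPS τ → τ ⊴LPS ρ → σ ⊴LPS ρ
  R2   : ∀ {σ σ′ τ τ′} → σ ⊴LPS σ′ → τ ⊴LPS τ′ → σ ⇒ τ ⊴LPS σ′ ⇒ τ′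

-- Church-style terms up to α-conversion: intrinsically typed de Bruijn terms.
-- The environment E , (x : ρ) is ρ ∷ E.

Env : Set
Env = List Ty

infix  3 _⊢_
infixl 7 _·_

data _⊢_ : Env → Ty → Set where
  var : ∀ {E τ} → τ ∈ E → E ⊢ τ
  ƛ   : ∀ {E σ τ} → σ ∷ E ⊢ τ → E ⊢ σ ⇒ τ
  _·_ : ∀ {E σ τ} → E ⊢ σ ⇒ τ → E ⊢ σ → E ⊢ τ

rename : ∀ {E F τ} → E ⊆ F → E ⊢ τ → F ⊢ τ
rename r (var x) = var (r x)
rename r (ƛ t)   = ƛ (rename (∷⁺ʳ _ r) t)
rename r (t · u) = rename r t · rename r u

weaken : ∀ {E ρ τ} → E ⊢ τ → ρ ∷ E ⊢ τ
weaken = rename there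

Subst : Env → Env → Set
Subst E F = ∀ {τ} → τ ∈ E → F ⊢ τ

lift : ∀ {E F ρ} → Subst E F → Subst (ρ ∷ E) (ρ ∷ F)
lift s (here refl) = var (here refl)
lift s (there x)   = weaken (s x)

subst : ∀ {E F τ} → Subst E F → E ⊢ τ → F ⊢ τ
subst s (var x) = s x
subst s (ƛ t)   = ƛ (subst (lift s) t)
subst s (t · u) = subst s t · subst s u

single : ∀ {E ρ} → E ⊢ ρ → Subst (ρ ∷ E) E
single u (here refl) = u
single u (there x)   = var x

_[_] : ∀ {E ρ τ} → ρ ∷ E ⊢ τ → E ⊢ ρ → E ⊢ τ
t [ u ] = subst (single u) t

infix 4 _=βη_

data _=βη_ : ∀ {E τ} → E ⊢ τ → E ⊢ τ → Set where
  β      : ∀ {E σ τ} (t : σ ∷ E ⊢ τ) (u : E ⊢ σ) → ƛ t · u =βη t [ u ]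
  η      : ∀ {E σ τ} (t : E ⊢ σ ⇒ τ) → ƛ (weaken t · var (here refl)) =βη t
  ƛ-cong : ∀ {E σ τ} {t t′ : σ ∷ E ⊢ τ} → t =βη t′ → ƛ t =βη ƛ t′
  ·-cong : ∀ {E σ τ} {t t′ : E ⊢ σ ⇒ τ} {u u′ : E ⊢ σ} →
           t =βη t′ → u =βη u′ → t · u =βη t′ · u′
  =-refl  : ∀ {E τ} {t : E ⊢ τ} → t =βη t
  =-sym   : ∀ {E τ} {t u : E ⊢ τ} → t =βη u → u =βη t
  =-trans : ∀ {E τ} {t u v : E ⊢ τ} → t =βη u → u =βη v → t =βη v

occurrences : ∀ {E τ} → Fin (length E) → E ⊢ τ → ℕ
occurrences i (var x) = if does (i ≟ index x) then 1 else 0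
occurrences i (ƛ t)   = occurrences (suc i) t
occurrences i (t · u) = occurrences i t + occurrences i u

BoundAffine : ∀ {E τ} → E ⊢ τ → Set
BoundAffine (var x) = ⊤
BoundAffine (ƛ t)   = occurrences zero t ≤ 1 × BoundAffine t
BoundAffine (t · u) = BoundAffine t × BoundAffine u

-- Each variable, free or bound, occurs at most once; distinct binders bind
-- distinct variables, and the binder itself is not an occurrence.
Affine : ∀ {E τ} → E ⊢ τ → Set
Affine t = (∀ i → occurrences i t ≤ 1) × BoundAffine t

record Retraction (ρ τ : Ty) : Set where
  field
    env      : Env
    coder    : ρ ∷ env ⊢ τ
    -- Living over env alone, the decoder cannot mention x : ρ.
    decoder  : env ⊢ τ ⇒ ρ
    retracts : weaken decoder · coder =βη var (here refl)

infix 4 _⊴_ _⊴¹_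

_⊴_ : Ty → Ty → Set
ρ ⊴ τ = Retraction ρ τ

-- The coder and the decoder may have free variables in common.
_⊴¹_ : Ty → Ty → Set
ρ ⊴¹ τ = Σ[ r ∈ ρ ⊴ τ ] Affine (Retraction.coder r) × Affine (Retraction.decoder r)

{-# OPTIONS --safe #-}
module Submission where

-- Only rule D of CF needs work in LPS. By A4 and R2, Δ ⇛ a embeds into
-- ((Δ ⇛ a) ⇒ a) ⇒ a, hence into (Σ ⇛ (σ ⇒ a)) ⇒ a; the n premises are
-- treated one at a time, commuting the blocks of arguments by ∼.
-- For soundness, a retraction is read as a pair of affine functions code and
-- decode. These compose (R1) and act on both sides of an arrow (R2), the free
-- variables of the two premises being kept apart by concatenating environments.
-- The decoder of A4 is λF y₁ … yₖ. F (λx. x y₁ … yₖ), up to β.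

open import Defs
open import Data.Bool using (false; if_then_else_)
open import Data.Fin using (Fin; zero; suc; _≟_)
open import Data.List using (List; []; _∷_; _++_; concat; tabulate; length)
open import Data.List.Membership.Propositional using (_∈_)
open import Data.List.Membership.Propositional.Properties using (∈-++⁺ˡ; ∈-++⁺ʳ)
open import Data.List.Properties using (foldr-++)
open import Data.List.Relation.Binary.Subset.Propositional using (_⊆_)
open import Data.List.Relation.Binary.Subset.Propositional.Properties using (∷⁺ʳ)
open import Data.List.Relation.Unary.Any using (here; there; index)
open import Data.Nat using (ℕ; _+_; _≤_; z≤n; s≤s)
open import Data.Nat.Properties using (+-identityʳ; +-comm; ≤-reflexive; ≤-trans)
open import Data.Product using (Σ-syntax; _×_; _,_; proj₁; proj₂; swap)
open import Data.Sum using (_⊎_; inj₁; inj₂)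
open import Data.Unit using (tt)
open import Function using (_∘_)
open import Relation.Binary.Bundles using (Setoid)
open import Relation.Binary.PropositionalEquality
  using (_≡_; refl; sym; trans; cong; cong₂; module ≡-Reasoning)
import Relation.Binary.PropositionalEquality as ≡
import Relation.Binary.Reasoning.Setoid as SetoidReasoning
open import Relation.Nullary using (does)

-- Translation of CF derivations into LPS

head-⇛ : ∀ Δ {ρ} → head (Δ ⇛ ρ) ≡ head ρ
head-⇛ []      = refl
head-⇛ (_ ∷ Δ) = head-⇛ Δ

⇛-insert : ∀ Σs {τ ρ} → Σs ⇛ (τ ⇒ ρ) ∼ τ ⇒ (Σs ⇛ ρ)
⇛-insert []       = ∼-refl
⇛-insert (_ ∷ Σs) = ∼-trans (∼-cong ∼-refl (⇛-insert Σs)) ∼-swap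

⇛-comm : ∀ Σs Δ {ρ} → Σs ⇛ (Δ ⇛ ρ) ∼ Δ ⇛ (Σs ⇛ ρ)
⇛-comm []       Δ = ∼-refl
⇛-comm (_ ∷ Σs) Δ =
  ∼-trans (∼-cong ∼-refl (⇛-comm Σs Δ)) (∼-sym (⇛-insert Δ))

∼⇒LPS : ∀ {σ τ} → σ ∼ τ → σ ⊴LPS τ
∼⇒LPS p = conv ∼-refl p A1

LPS-⇛-mono : ∀ Σs {σ τ} → σ ⊴LPS τ → Σs ⇛ σ ⊴LPS Σs ⇛ τ
LPS-⇛-mono []       p = p
LPS-⇛-mono (_ ∷ Σs) p = R2 A1 (LPS-⇛-mono Σs p)

LPS-N : ∀ Σs {ρ} → ρ ⊴LPS Σs ⇛ ρ
LPS-N []       = A1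
LPS-N (_ ∷ Σs) = R1 (LPS-N Σs) A2

LPS-D₁ : ∀ Δ Σs {σ a} → Δ ⇛ ` a ⊴LPS σ → Δ ⇛ ` a ⊴LPS (Σs ⇛ (σ ⇒ ` a)) ⇒ ` a
LPS-D₁ Δ Σs p =
  -- `R2` is covariant on both sides of the arrow, because a retraction carries maps in both
  -- directions; so `p` applies unchanged two levels deep on the left.
  R1 (A4 (head-⇛ Δ)) (R2 (R1 (R2 p A1) (LPS-N Σs)) A1)

LPS-D : ∀ {a n} (Δ Σs : Fin n → List Ty) (σ : Fin n → Ty) →
        (∀ i → Δ i ⇛ ` a ⊴LPS σ i) →
        concat (tabulate Δ) ⇛ ` a
          ⊴LPS tabulate (λ i → Σs i ⇛ (σ i ⇒ ` a)) ⇛ ` a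
LPS-D {n = ℕ.zero} Δ Σs σ p = A1
LPS-D {a} {ℕ.suc n} Δ Σs σ p =
  ≡.subst (_⊴LPS _) (sym (foldr-++ _⇒_ (` a) (Δ zero) (concat (tabulate (Δ ∘ suc)))))
    -- The remaining premises are treated underneath the arguments `Δ zero`. These arguments are
    -- then moved next to the atom, where the one-premise case applies, and the new argument is
    -- finally brought to the front.
    (R1 (LPS-⇛-mono (Δ zero) (LPS-D (Δ ∘ suc) (Σs ∘ suc) (σ ∘ suc) (p ∘ suc)))
    (R1 (∼⇒LPS (⇛-comm (Δ zero) Xs))
    (R1 (LPS-⇛-mono Xs (LPS-D₁ (Δ zero) (Σs zero) (p zero)))
        (∼⇒LPS (⇛-insert Xs)))))
  where
  Xs : List Ty
  Xs = tabulate (λ i → Σs (suc i) ⇛ (σ (suc i) ⇒ ` a))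

CF⇒LPS : ∀ {σ τ} → σ ⊴CF τ → σ ⊴LPS τ
CF⇒LPS (conv p q d)  = conv p q (CF⇒LPS d)
CF⇒LPS Ax            = A1
CF⇒LPS (H d e)       = R2 (CF⇒LPS d) (CF⇒LPS e)
CF⇒LPS (N Σs d)      = R1 (CF⇒LPS d) (LPS-N Σs)
CF⇒LPS (D Δ Σs σ ds) = LPS-D Δ Σs σ (λ i → CF⇒LPS (ds i))

-- Renaming and substitution

v₀ : ∀ {E σ} → σ ∷ E ⊢ σ
v₀ = var (here refl)

v₁ : ∀ {E σ τ} → τ ∷ σ ∷ E ⊢ σ
v₁ = var (there (here refl))

v₂ : ∀ {E σ τ ρ} → ρ ∷ τ ∷ σ ∷ E ⊢ σ
v₂ = var (there (there (here refl)))

∷⁺ʳ-∘ : ∀ {E F G : Env} {ρ} {r : F ⊆ G} {s : E ⊆ F} {q : E ⊆ G} →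
        (∀ {τ} (x : τ ∈ E) → r (s x) ≡ q x) →
        ∀ {τ} (x : τ ∈ ρ ∷ E) → ∷⁺ʳ ρ r (∷⁺ʳ ρ s x) ≡ ∷⁺ʳ ρ q x
∷⁺ʳ-∘ eq (here refl) = refl
∷⁺ʳ-∘ eq (there x)   = cong there (eq x)

rename-rename : ∀ {E F G τ} {r : F ⊆ G} {s : E ⊆ F} {q : E ⊆ G} →
                (∀ {τ} (x : τ ∈ E) → r (s x) ≡ q x) →
                (t : E ⊢ τ) → rename r (rename s t) ≡ rename q t
rename-rename eq (var x) = cong var (eq x)
rename-rename eq (ƛ t)   = cong ƛ (rename-rename (∷⁺ʳ-∘ eq) t)
rename-rename eq (t · u) = cong₂ _·_ (rename-rename eq t) (rename-rename eq u)

rename-id : ∀ {E τ} {r : E ⊆ E} → (∀ {τ} (x : τ ∈ E) → r x ≡ x) →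
            (t : E ⊢ τ) → rename r t ≡ t
rename-id eq (var x) = cong var (eq x)
rename-id {E} {r = r} eq (ƛ {σ = ρ} t) = cong ƛ (rename-id eq′ t)
  where
  eq′ : ∀ {τ} (x : τ ∈ ρ ∷ E) → ∷⁺ʳ ρ r x ≡ x
  eq′ (here refl) = refl
  eq′ (there x)   = cong there (eq x)
rename-id eq (t · u) = cong₂ _·_ (rename-id eq t) (rename-id eq u)

-- In the β-steps below, the component terms of a combinator occur only in weakened form, so
-- substitution merely drops the added variables and amounts to a renaming.
subst-rename : ∀ {E F G τ} {s : Subst F G} {r : E ⊆ F} {q : E ⊆ G} →
               (∀ {τ} (x : τ ∈ E) → s (r x) ≡ var (q x)) →
               (t : E ⊢ τ) → subst s (rename r t) ≡ rename q t
subst-rename eq (var x) = eq x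
subst-rename {E} {s = s} {r} {q} eq (ƛ {σ = ρ} t) = cong ƛ (subst-rename eq′ t)
  where
  eq′ : ∀ {τ} (x : τ ∈ ρ ∷ E) → lift s (∷⁺ʳ ρ r x) ≡ var (∷⁺ʳ ρ q x)
  eq′ (here refl) = refl
  eq′ (there x)   = cong weaken (eq x)
subst-rename eq (t · u) = cong₂ _·_ (subst-rename eq t) (subst-rename eq u)

weaken-[] : ∀ {E ρ τ} (t : E ⊢ τ) (u : E ⊢ ρ) → weaken t [ u ] ≡ t
weaken-[] t u =
  trans (subst-rename {q = λ x → x} (λ _ → refl) t) (rename-id (λ _ → refl) t)

weaken-rename : ∀ {E F ρ τ} (r : E ⊆ F) (t : E ⊢ τ) →
                weaken {ρ = ρ} (rename r t) ≡ rename (λ x → there (r x)) t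
weaken-rename r = rename-rename (λ _ → refl)

rename-weaken-[] : ∀ {E F ρ τ} (r : E ⊆ F) (t : E ⊢ τ) (u : F ⊢ ρ) →
                   rename (∷⁺ʳ ρ r) (weaken t) [ u ] ≡ rename r t
rename-weaken-[] r t u = trans
  (cong (_[ u ]) (rename-rename {q = λ x → there (r x)} (λ _ → refl) t))
  (subst-rename (λ _ → refl) t)

-- This is what two successive β-steps make of a component placed under two binders: each
-- substitution cancels one weakening.
rename-weaken²-[] : ∀ {E F ρ ρ′ τ} (r : E ⊆ F) (t : E ⊢ τ) (u : F ⊢ ρ) (u′ : F ⊢ ρ′) →
  subst (lift (single u)) (rename (∷⁺ʳ ρ′ (∷⁺ʳ ρ r)) (weaken (weaken t))) [ u′ ] ≡ rename r t
rename-weaken²-[] {ρ = ρ} {ρ′} r t u u′ = begin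
  subst (lift (single u)) (rename (∷⁺ʳ ρ′ (∷⁺ʳ ρ r)) (weaken (weaken t))) [ u′ ]
    ≡⟨ cong (λ z → subst (lift (single u)) (rename (∷⁺ʳ ρ′ (∷⁺ʳ ρ r)) z) [ u′ ])
            (rename-rename {q = λ x → there (there x)} (λ _ → refl) t) ⟩
  subst (lift (single u)) (rename (∷⁺ʳ ρ′ (∷⁺ʳ ρ r)) (rename (λ x → there (there x)) t)) [ u′ ]
    ≡⟨ cong (λ z → subst (lift (single u)) z [ u′ ])
            (rename-rename {q = λ x → there (there (r x))} (λ _ → refl) t) ⟩
  subst (lift (single u)) (rename (λ x → there (there (r x))) t) [ u′ ]
    ≡⟨ cong (_[ u′ ]) (subst-rename {q = λ x → there (r x)} (λ _ → refl) t) ⟩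
  rename (λ x → there (r x)) t [ u′ ]
    ≡⟨ subst-rename (λ _ → refl) t ⟩
  rename r t ∎
  where open ≡-Reasoning

-- βη-equality

βη-setoid : Env → Ty → Setoid _ _
βη-setoid E τ = record
  { Carrier       = E ⊢ τ
  ; _≈_           = _=βη_
  ; isEquivalence = record { refl = =-refl ; sym = =-sym ; trans = =-trans }
  }

module βη-Reasoning {E τ} = SetoidReasoning (βη-setoid E τ)
open βη-Reasoning

=-reflexive : ∀ {E τ} {t u : E ⊢ τ} → t ≡ u → t =βη u
=-reflexive refl = =-refl

·-congˡ : ∀ {E σ τ} {t : E ⊢ σ ⇒ τ} {u u′ : E ⊢ σ} → u =βη u′ → t · u =βη t · u′
·-congˡ = ·-cong =-refl

·-congʳ : ∀ {E σ τ} {t t′ : E ⊢ σ ⇒ τ} {u : E ⊢ σ} → t =βη t′ → t · u =βη t′ · u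
·-congʳ p = ·-cong p =-refl

extensionality : ∀ {E σ τ} {t u : E ⊢ σ ⇒ τ} → weaken t · v₀ =βη weaken u · v₀ → t =βη u
extensionality {t = t} {u} p = =-trans (=-sym (η t)) (=-trans (ƛ-cong p) (η u))

-- Counting occurrences

-- The hypothesis says that exactly the variable at `i` is sent to `j`. In Boolean form it passes
-- under a binder by computation, as `does (suc j ≟ suc k)` reduces to `does (j ≟ k)`.
occurrences-rename : ∀ {E F τ} {r : E ⊆ F} {i j} →
  (∀ {τ} (x : τ ∈ E) → does (j ≟ index (r x)) ≡ does (i ≟ index x)) →
  (t : E ⊢ τ) → occurrences j (rename r t) ≡ occurrences i t
occurrences-rename eq (var x) = cong (λ b → if b then 1 else 0) (eq x)
occurrences-rename {E} {r = r} {i} {j} eq (ƛ {σ = ρ} t) = occurrences-rename eq′ t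
  where
  eq′ : ∀ {τ} (x : τ ∈ ρ ∷ E) → does (suc j ≟ index (∷⁺ʳ ρ r x)) ≡ does (suc i ≟ index x)
  eq′ (here refl) = refl
  eq′ (there x)   = eq x
occurrences-rename eq (t · u) =
  cong₂ _+_ (occurrences-rename eq t) (occurrences-rename eq u)

occurrences-rename-∉ : ∀ {E F τ} {r : E ⊆ F} {j} →
  (∀ {τ} (x : τ ∈ E) → does (j ≟ index (r x)) ≡ false) →
  (t : E ⊢ τ) → occurrences j (rename r t) ≡ 0
occurrences-rename-∉ eq (var x) = cong (λ b → if b then 1 else 0) (eq x)
occurrences-rename-∉ {E} {r = r} {j} eq (ƛ {σ = ρ} t) = occurrences-rename-∉ eq′ t
  where
  eq′ : ∀ {τ} (x : τ ∈ ρ ∷ E) → does (suc j ≟ index (∷⁺ʳ ρ r x)) ≡ false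
  eq′ (here refl) = refl
  eq′ (there x)   = eq x
occurrences-rename-∉ eq (t · u) =
  cong₂ _+_ (occurrences-rename-∉ eq t) (occurrences-rename-∉ eq u)

-- This holds even for renamings that identify free variables: a lifted renaming fixes the bound
-- variable and sends no other variable to it.
BoundAffine-rename : ∀ {E F τ} (r : E ⊆ F) (t : E ⊢ τ) → BoundAffine t → BoundAffine (rename r t)
BoundAffine-rename r (var x) _ = tt
BoundAffine-rename {E} r (ƛ {σ = ρ} t) (p , q) =
  ≡.subst (_≤ 1) (sym (occurrences-rename eq t)) p , BoundAffine-rename (∷⁺ʳ ρ r) t q
  where
  eq : ∀ {τ} (x : τ ∈ ρ ∷ E) → does (zero ≟ index (∷⁺ʳ ρ r x)) ≡ does (zero ≟ index x)
  eq (here refl) = refl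
  eq (there x)   = refl
BoundAffine-rename r (t · u) (p , q) = BoundAffine-rename r t p , BoundAffine-rename r u q

occurrences-weaken : ∀ {E ρ τ} i (t : E ⊢ τ) → occurrences (suc i) (weaken {ρ = ρ} t) ≡ occurrences i t
occurrences-weaken i = occurrences-rename (λ _ → refl)

occurrences-weaken₀ : ∀ {E ρ τ} (t : E ⊢ τ) → occurrences zero (weaken {ρ = ρ} t) ≡ 0
occurrences-weaken₀ = occurrences-rename-∉ (λ _ → refl)

occurrences-weaken² : ∀ {E ρ ρ′ τ} i (t : E ⊢ τ) →
  occurrences (suc (suc i)) (weaken {ρ = ρ} (weaken {ρ = ρ′} t)) ≡ occurrences i t
occurrences-weaken² i t = trans (occurrences-weaken (suc i) (weaken t)) (occurrences-weaken i t)

occurrences-weaken²₁ : ∀ {E ρ ρ′ τ} (t : E ⊢ τ) →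
  occurrences (suc zero) (weaken {ρ = ρ} (weaken {ρ = ρ′} t)) ≡ 0
occurrences-weaken²₁ t = trans (occurrences-weaken zero (weaken t)) (occurrences-weaken₀ t)

-- Terms over concatenated environments and joint affinity

inˡ : ∀ {E} F {τ} → E ⊢ τ → E ++ F ⊢ τ
inˡ F = rename ∈-++⁺ˡ

inʳ : ∀ E {F τ} → F ⊢ τ → E ++ F ⊢ τ
inʳ E = rename (∈-++⁺ʳ E)

-- Stated with `does (_ ≟ _)`, the Boolean on which `occurrences` branches.
++-split : ∀ (E F : Env) (j : Fin (length (E ++ F))) →
  (Σ[ i ∈ Fin (length E) ]
    (∀ {τ} (x : τ ∈ E) → does (j ≟ index (∈-++⁺ˡ {ys = F} x)) ≡ does (i ≟ index x)) ×
    (∀ {τ} (x : τ ∈ F) → does (j ≟ index (∈-++⁺ʳ E x)) ≡ false))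
  ⊎
  (Σ[ i ∈ Fin (length F) ]
    (∀ {τ} (x : τ ∈ E) → does (j ≟ index (∈-++⁺ˡ {ys = F} x)) ≡ false) ×
    (∀ {τ} (x : τ ∈ F) → does (j ≟ index (∈-++⁺ʳ E x)) ≡ does (i ≟ index x)))
++-split []      F j       = inj₂ (j , (λ ()) , (λ _ → refl))
++-split (ρ ∷ E) F zero    =
  inj₁ (zero , (λ { (here refl) → refl ; (there x) → refl }) , (λ _ → refl))
++-split (ρ ∷ E) F (suc j) with ++-split E F j
... | inj₁ (i , p , q) =
  inj₁ (suc i , (λ { (here refl) → refl ; (there x) → p x }) , q)
... | inj₂ (i , p , q) =
  inj₂ (i , (λ { (here refl) → refl ; (there x) → p x }) , q)

-- The condition for an application of `p` to `q` to be affine, freed from the typing constraint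
-- under which that application is a term.
record JointlyAffine {E σ τ} (p : E ⊢ σ) (q : E ⊢ τ) : Set where
  constructor jointlyAffine
  field
    occurrences-≤ : ∀ i → occurrences i p + occurrences i q ≤ 1
    boundˡ        : BoundAffine p
    boundʳ        : BoundAffine q

JointlyAffine-sym : ∀ {E σ τ} {p : E ⊢ σ} {q : E ⊢ τ} → JointlyAffine p q → JointlyAffine q p
JointlyAffine-sym {p = p} {q} (jointlyAffine o b b′) =
  jointlyAffine (λ i → ≡.subst (_≤ 1) (+-comm (occurrences i p) (occurrences i q)) (o i)) b′ b

-- Each variable of `E ++ F` comes from one side only, so one of the two counts is zero and the
-- other is bounded by affinity of `p` or of `q`.
JointlyAffine-++ : ∀ {E F σ τ} {p : E ⊢ σ} {q : F ⊢ τ} →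
                   Affine p → Affine q → JointlyAffine (inˡ F p) (inʳ E q)
JointlyAffine-++ {E} {F} {p = p} {q} (op , bp) (oq , bq) =
  jointlyAffine occ (BoundAffine-rename _ p bp) (BoundAffine-rename _ q bq)
  where
  occ : ∀ j → occurrences j (inˡ F p) + occurrences j (inʳ E q) ≤ 1
  occ j with ++-split E F j
  ... | inj₁ (i , l , r) = ≤-trans (≤-reflexive (trans
    (cong₂ _+_ (occurrences-rename {i = i} {j} l p) (occurrences-rename-∉ {j = j} r q)) (+-identityʳ _))) (op i)
  ... | inj₂ (i , l , r) = ≤-trans (≤-reflexive
    (cong₂ _+_ (occurrences-rename-∉ {j = j} l p) (occurrences-rename {i = i} {j} r q))) (oq i)

-- Combinators

compose : ∀ {E ρ σ τ} → E ⊢ σ ⇒ τ → E ⊢ ρ ⇒ σ → E ⊢ ρ ⇒ τ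
compose p q = ƛ (weaken p · (weaken q · v₀))

-- The renaming is included because `LeftInverse` speaks of renamed copies of the two maps.
compose-β : ∀ {E F ρ σ τ} (r : E ⊆ F) (p : E ⊢ σ ⇒ τ) (q : E ⊢ ρ ⇒ σ) u →
            rename r (compose p q) · u =βη rename r p · (rename r q · u)
compose-β r p q u = =-trans (β _ u) (=-reflexive
  (cong₂ (λ p′ q′ → p′ · (q′ · u)) (rename-weaken-[] r p u) (rename-weaken-[] r q u)))

compose-affine : ∀ {E ρ σ τ} {p : E ⊢ σ ⇒ τ} {q : E ⊢ ρ ⇒ σ} →
                 JointlyAffine p q → Affine (compose p q)
compose-affine {p = p} {q} (jointlyAffine o bp bq) =
  occ , occ₀ , BoundAffine-rename _ p bp , BoundAffine-rename _ q bq , tt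
  where
  occ : ∀ i → occurrences i (compose p q) ≤ 1
  occ i = ≤-trans (≤-reflexive (cong₂ _+_ (occurrences-weaken i p)
    (trans (+-identityʳ _) (occurrences-weaken i q)))) (o i)
  occ₀ : occurrences zero (weaken p · (weaken q · v₀)) ≤ 1
  occ₀ = ≤-reflexive (cong₂ (λ m n → m + (n + 1)) (occurrences-weaken₀ p) (occurrences-weaken₀ q))

-- The functorial action of the arrow, contravariant in its first argument. One combinator provides
-- both the coder and the decoder of an arrow type.
mapArrow : ∀ {E σ σ′ τ τ′} → E ⊢ σ′ ⇒ σ → E ⊢ τ ⇒ τ′ → E ⊢ (σ ⇒ τ) ⇒ σ′ ⇒ τ′
mapArrow p q = ƛ (ƛ (weaken (weaken q) · (v₁ · (weaken (weaken p) · v₀))))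

mapArrow-β : ∀ {E F σ σ′ τ τ′} (r : E ⊆ F) (p : E ⊢ σ′ ⇒ σ) (q : E ⊢ τ ⇒ τ′) f u →
             rename r (mapArrow p q) · f · u =βη rename r q · (f · (rename r p · u))
mapArrow-β r p q f u = begin
  rename r (mapArrow p q) · f · u
    ≈⟨ ·-congʳ (β _ f) ⟩
  _
    ≈⟨ β _ u ⟩
  _
    ≈⟨ =-reflexive (cong₂ _·_ (rename-weaken²-[] r q f u)
         (cong₂ (λ f′ p′ → f′ · (p′ · u)) (weaken-[] f u) (rename-weaken²-[] r p f u))) ⟩
  rename r q · (f · (rename r p · u)) ∎

mapArrow-affine : ∀ {E σ σ′ τ τ′} {p : E ⊢ σ′ ⇒ σ} {q : E ⊢ τ ⇒ τ′} →
                  JointlyAffine q p → Affine (mapArrow p q)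
mapArrow-affine {p = p} {q} (jointlyAffine o bq bp) =
  occ , occ₁ , occ₀ , bound q bq , tt , bound p bp , tt
  where
  bound : ∀ {E ρ ρ′ τ} (t : E ⊢ τ) → BoundAffine t →
          BoundAffine (weaken {ρ = ρ} (weaken {ρ = ρ′} t))
  bound t b = BoundAffine-rename there (weaken t) (BoundAffine-rename there t b)
  occ : ∀ i → occurrences i (mapArrow p q) ≤ 1
  occ i = ≤-trans (≤-reflexive (cong₂ _+_ (occurrences-weaken² i q)
    (trans (+-identityʳ _) (occurrences-weaken² i p)))) (o i)
  occ₁ : occurrences zero (ƛ (weaken (weaken q) · (v₁ · (weaken (weaken p) · v₀)))) ≤ 1
  occ₁ = ≤-reflexive (cong₂ (λ m n → m + (1 + (n + 0)))
    (occurrences-weaken²₁ q) (occurrences-weaken²₁ p))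
  occ₀ : occurrences zero (weaken (weaken q) · (v₁ · (weaken (weaken p) · v₀))) ≤ 1
  occ₀ = ≤-reflexive (cong₂ (λ m n → m + (n + 1))
    (occurrences-weaken₀ (weaken q)) (occurrences-weaken₀ (weaken p)))

-- Affine retractions given by a pair of functions

-- Quantifying over all renamings makes the law stable under weakening without
-- a proof that _=βη_ is closed under renaming.
LeftInverse : ∀ {E ρ τ} → E ⊢ ρ ⇒ τ → E ⊢ τ ⇒ ρ → Set
LeftInverse {E} {ρ} c d =
  ∀ {F} (r : E ⊆ F) (u : F ⊢ ρ) → rename r d · (rename r c · u) =βη u

LeftInverse-rename : ∀ {E F ρ τ} {c : E ⊢ ρ ⇒ τ} {d : E ⊢ τ ⇒ ρ} (s : E ⊆ F) →
                     LeftInverse c d → LeftInverse (rename s c) (rename s d)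
LeftInverse-rename {c = c} {d} s inv r u = =-trans
  (=-reflexive (cong₂ (λ d′ c′ → d′ · (c′ · u))
    (rename-rename {q = λ x → r (s x)} (λ _ → refl) d) (rename-rename (λ _ → refl) c)))
  (inv (λ x → r (s x)) u)

-- Coder and decoder are both functions over one environment. This symmetric form lets them be
-- composed and exchange roles on the left of an arrow.
record AffineRetract (ρ τ : Ty) : Set where
  field
    {env}   : Env
    code    : env ⊢ ρ ⇒ τ
    decode  : env ⊢ τ ⇒ ρ
    affineᶜ : Affine code
    affineᵈ : Affine decode
    inverse : LeftInverse code decode

open AffineRetract

AffineRetract⇒⊴¹ : ∀ {ρ τ} → AffineRetract ρ τ → ρ ⊴¹ τ
AffineRetract⇒⊴¹ R =
  record { env      = env R
         ; coder    = weaken c · v₀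
         ; decoder  = decode R
         -- At the renaming `there` and the argument `v₀`, the inverse law is literally the required
         -- equation.
         ; retracts = inverse R there v₀
         } ,
  (occ , BoundAffine-rename there c (proj₂ (affineᶜ R)) , tt) ,
  affineᵈ R
  where
  c = code R
  occ : ∀ i → occurrences i (weaken c · v₀) ≤ 1
  occ zero    = ≤-reflexive (cong (_+ 1) (occurrences-weaken₀ c))
  occ (suc i) = ≤-trans
    (≤-reflexive (trans (+-identityʳ _) (occurrences-weaken i c))) (proj₁ (affineᶜ R) i)

retract-refl : ∀ {σ} → AffineRetract σ σ
retract-refl = record
  { env     = []
  ; code    = ƛ v₀
  ; decode  = ƛ v₀
  ; affineᶜ = (λ ()) , s≤s z≤n , tt
  ; affineᵈ = (λ ()) , s≤s z≤n , tt
  ; inverse = λ r u → =-trans (β _ _) (β _ _)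
  }

retract-trans : ∀ {ρ σ τ} → AffineRetract ρ σ → AffineRetract σ τ → AffineRetract ρ τ
retract-trans {ρ} {σ} {τ} R S = record
  { code    = compose c₂ c₁
  ; decode  = compose d₁ d₂
  ; affineᶜ = compose-affine (JointlyAffine-sym (JointlyAffine-++ (affineᶜ R) (affineᶜ S)))
  ; affineᵈ = compose-affine (JointlyAffine-++ (affineᵈ R) (affineᵈ S))
  ; inverse = inv
  }
  where
  c₁ = inˡ (env S) (code R)
  d₁ = inˡ (env S) (decode R)
  c₂ = inʳ (env R) (code S)
  d₂ = inʳ (env R) (decode S)
  inv : LeftInverse (compose c₂ c₁) (compose d₁ d₂)
  inv r u = begin
    rename r (compose d₁ d₂) · (rename r (compose c₂ c₁) · u)
      ≈⟨ compose-β r d₁ d₂ _ ⟩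
    rename r d₁ · (rename r d₂ · (rename r (compose c₂ c₁) · u))
      ≈⟨ ·-congˡ (·-congˡ (compose-β r c₂ c₁ u)) ⟩
    rename r d₁ · (rename r d₂ · (rename r c₂ · (rename r c₁ · u)))
      ≈⟨ ·-congˡ (LeftInverse-rename (∈-++⁺ʳ (env R)) (inverse S) r _) ⟩
    rename r d₁ · (rename r c₁ · u)
      ≈⟨ LeftInverse-rename ∈-++⁺ˡ (inverse R) r u ⟩
    u ∎

-- On the left of the arrow the coder uses the decoder of `R`, and the decoder uses its coder.
-- Around `f` the two then compose to `d₁` after `c₁`, which again cancels by the law of `R`.
retract-⇒ : ∀ {σ σ′ τ τ′} → AffineRetract σ σ′ → AffineRetract τ τ′ →
            AffineRetract (σ ⇒ τ) (σ′ ⇒ τ′)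
retract-⇒ R S = record
  { code    = mapArrow d₁ c₂
  ; decode  = mapArrow c₁ d₂
  ; affineᶜ = mapArrow-affine (JointlyAffine-sym (JointlyAffine-++ (affineᵈ R) (affineᶜ S)))
  ; affineᵈ = mapArrow-affine (JointlyAffine-sym (JointlyAffine-++ (affineᶜ R) (affineᵈ S)))
  ; inverse = inv
  }
  where
  c₁ = inˡ (env S) (code R)
  d₁ = inˡ (env S) (decode R)
  c₂ = inʳ (env R) (code S)
  d₂ = inʳ (env R) (decode S)
  inv : LeftInverse (mapArrow d₁ c₂) (mapArrow c₁ d₂)
  inv {F} r f = extensionality (begin
    weaken (rename r D′) · (weaken (rename r C′) · weaken f) · v₀
      ≈⟨ =-reflexive (cong₂ (λ d c → d · (c · weaken f) · v₀)
           (weaken-rename r D′) (weaken-rename r C′)) ⟩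
    rename r′ D′ · (rename r′ C′ · weaken f) · v₀
      ≈⟨ mapArrow-β r′ c₁ d₂ _ _ ⟩
    rename r′ d₂ · (rename r′ C′ · weaken f · (rename r′ c₁ · v₀))
      ≈⟨ ·-congˡ (mapArrow-β r′ d₁ c₂ _ _) ⟩
    rename r′ d₂ · (rename r′ c₂ · (weaken f · (rename r′ d₁ · (rename r′ c₁ · v₀))))
      ≈⟨ LeftInverse-rename (∈-++⁺ʳ (env R)) (inverse S) r′ _ ⟩
    weaken f · (rename r′ d₁ · (rename r′ c₁ · v₀))
      ≈⟨ ·-congˡ (LeftInverse-rename ∈-++⁺ˡ (inverse R) r′ _) ⟩
    weaken f · v₀ ∎)
    where
    C′ = mapArrow d₁ c₂
    D′ = mapArrow c₁ d₂
    -- Extensionality adds a fresh variable, so the laws of `R` and `S` are used at this longer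
    -- renaming.
    r′ : ∀ {ρ} → env R ++ env S ⊆ ρ ∷ F
    r′ x = there (r x)

-- Isomorphic types as mutual affine retracts

exchange : ∀ {E σ τ ρ} → E ⊢ (σ ⇒ τ ⇒ ρ) ⇒ τ ⇒ σ ⇒ ρ
exchange = ƛ (ƛ (ƛ (v₂ · v₀ · v₁)))

exchange-β : ∀ {E σ τ ρ} (f : E ⊢ σ ⇒ τ ⇒ ρ) t s → exchange · f · t · s =βη f · s · t
exchange-β f t s = begin
  exchange · f · t · s
    ≈⟨ ·-congʳ (·-congʳ (β _ f)) ⟩
  ƛ (ƛ (weaken (weaken f) · v₀ · v₁)) · t · s
    ≈⟨ ·-congʳ (β _ t) ⟩
  ƛ (subst (lift (single t)) (weaken (weaken f)) · v₀ · weaken t) · s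
    ≈⟨ β _ s ⟩
  subst (lift (single t)) (weaken (weaken f)) [ s ] · s · weaken t [ s ]
    ≈⟨ =-reflexive (cong₂ (λ f′ t′ → f′ · s · t′) eq (weaken-[] t s)) ⟩
  f · s · t ∎
  where
  eq : subst (lift (single t)) (weaken (weaken f)) [ s ] ≡ f
  eq = trans
    (cong (_[ s ]) (trans
      (cong (subst (lift (single t))) (rename-rename {q = λ x → there (there x)} (λ _ → refl) f))
      (subst-rename {q = there} (λ _ → refl) f)))
    (weaken-[] f s)

retract-swap : ∀ {σ τ ρ} → AffineRetract (σ ⇒ τ ⇒ ρ) (τ ⇒ σ ⇒ ρ)
retract-swap {σ} {τ} {ρ} = record
  { env     = []
  ; code    = exchange
  ; decode  = exchange
  ; affineᶜ = exchange-affine σ τ ρ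
  ; affineᵈ = exchange-affine τ σ ρ
  -- Swapping twice restores the order of the arguments, as two fresh arguments show; `exchange` is
  -- closed, so its renamings compute to `exchange` itself.
  ; inverse = λ r f → extensionality (extensionality
      (=-trans (exchange-β _ _ _) (exchange-β _ _ _)))
  }
  where
  exchange-affine : ∀ σ τ ρ → Affine (exchange {[]} {σ} {τ} {ρ})
  exchange-affine σ τ ρ = (λ ()) , s≤s z≤n , s≤s z≤n , s≤s z≤n , (tt , tt) , tt

-- Both directions are built together because `∼-sym` interchanges them.
∼⇒retracts : ∀ {σ τ} → σ ∼ τ → AffineRetract σ τ × AffineRetract τ σ
∼⇒retracts ∼-refl        = retract-refl , retract-refl
∼⇒retracts (∼-sym p)     = swap (∼⇒retracts p)
∼⇒retracts (∼-trans p q) with ∼⇒retracts p | ∼⇒retracts q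
... | p₁ , p₂ | q₁ , q₂ = retract-trans p₁ q₁ , retract-trans q₂ p₂
∼⇒retracts (∼-cong p q)  with ∼⇒retracts p | ∼⇒retracts q
... | p₁ , p₂ | q₁ , q₂ = retract-⇒ p₁ q₁ , retract-⇒ p₂ q₂
∼⇒retracts ∼-swap        = retract-swap , retract-swap

-- Retractions for the axioms A2 and A4

retract-A2 : ∀ {σ τ} → AffineRetract σ (τ ⇒ σ)
retract-A2 {σ} {τ} = record
  -- The decoder has to feed some argument of type `τ` to its input, and a free variable supplies it
  -- even if `τ` has no closed term.
  { env     = τ ∷ []
  ; code    = ƛ (ƛ v₁)
  ; decode  = ƛ (v₀ · v₁)
  ; affineᶜ = (λ { zero → z≤n }) , s≤s z≤n , z≤n , tt
  ; affineᵈ = (λ { zero → s≤s z≤n }) , s≤s z≤n , tt , tt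
  ; inverse = λ r u → =-trans (β _ _) (=-trans (·-congʳ (β _ u))
      (=-trans (β _ _) (=-reflexive (weaken-[] u _))))
  }

applyTo : ∀ {E σ a} → E ⊢ σ ⇒ (σ ⇒ ` a) ⇒ ` a
applyTo = ƛ (ƛ (v₀ · v₁))

applyTo-β : ∀ {E σ a} (u : E ⊢ σ) (k : E ⊢ σ ⇒ ` a) → applyTo · u · k =βη k · u
applyTo-β u k = =-trans (·-congʳ (β _ u))
  (=-trans (β _ k) (=-reflexive (cong (k ·_) (weaken-[] u k))))

unapply : ∀ σ {a} → head σ ≡ a → [] ⊢ ((σ ⇒ ` a) ⇒ ` a) ⇒ σ
-- The head condition makes the answer type the type to be decoded, so the identity is an admissible
-- continuation.
unapply (` a)   refl = ƛ (v₀ · ƛ v₀)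
unapply (σ ⇒ τ) eq   =
  -- With bound variables F, y, k, x from the outside in, the recursive call receives λk. F (λx. k
  -- (x y)), of type `(τ ⇒` a) ⇒ `a`.
  ƛ (ƛ (weaken (weaken (unapply τ eq)) · ƛ (v₂ · ƛ (v₁ · (v₀ · v₂)))))

unapply-affine : ∀ σ {a} (eq : head σ ≡ a) → Affine (unapply σ eq)
unapply-affine (` a)   refl = (λ ()) , s≤s z≤n , tt , s≤s z≤n , tt
unapply-affine (σ ⇒ τ) eq   =
  (λ ()) , occ₁ , occ₀ ,
  BoundAffine-rename there (weaken d) (BoundAffine-rename there d (proj₂ (unapply-affine τ eq))) ,
  s≤s z≤n , tt , s≤s z≤n , tt , tt , tt
  where
  d = unapply τ eq
  body = weaken {ρ = σ} (weaken d) · ƛ (v₂ · ƛ (v₁ · (v₀ · v₂)))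
  occ₁ : occurrences (suc zero) body ≤ 1
  occ₁ = ≤-reflexive (cong (_+ 1) (occurrences-weaken²₁ d))
  occ₀ : occurrences zero body ≤ 1
  occ₀ = ≤-reflexive (cong (_+ 1) (occurrences-weaken₀ (weaken d)))

unapply-β : ∀ {E} σ τ {a} (eq : head τ ≡ a) (r : [] ⊆ E) (f : E ⊢ ((σ ⇒ τ) ⇒ ` a) ⇒ ` a) (u : E ⊢ σ) →
  rename r (unapply (σ ⇒ τ) eq) · f · u
    =βη rename r (unapply τ eq) · ƛ (weaken f · ƛ (v₁ · (v₀ · weaken (weaken u))))
unapply-β σ τ eq r f u = begin
  rename r (unapply (σ ⇒ τ) eq) · f · u
    ≈⟨ ·-congʳ (β _ f) ⟩
  _
    ≈⟨ β _ u ⟩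
  _
    ≈⟨ =-reflexive (cong₂ (λ d f′ → d · ƛ (f′ · ƛ (v₁ · (v₀ · weaken (weaken u)))))
         (rename-weaken²-[] r (unapply τ eq) f u) eq′) ⟩
  rename r (unapply τ eq) · ƛ (weaken f · ƛ (v₁ · (v₀ · weaken (weaken u)))) ∎
  where
  eq′ : subst (lift (single u)) (weaken (weaken f)) ≡ weaken f
  eq′ = trans
    (cong (subst (lift (single u))) (rename-rename {q = λ x → there (there x)} (λ _ → refl) f))
    (subst-rename (λ _ → refl) f)

-- By induction on `σ`: decoding `applyTo · f` at an argument y reduces to decoding `applyTo` of f y
-- at the codomain.
unapply-inverse : ∀ σ {a} (eq : head σ ≡ a) → LeftInverse applyTo (unapply σ eq)
unapply-inverse (` a) refl r u =
  =-trans (β _ _) (=-trans (applyTo-β u (ƛ v₀)) (β _ u))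
unapply-inverse (σ ⇒ τ) eq {F} r f = extensionality (begin
  weaken (rename r (unapply (σ ⇒ τ) eq)) · (applyTo · weaken f) · v₀
    ≈⟨ =-reflexive (cong (λ d → d · (applyTo · weaken f) · v₀)
         (weaken-rename r (unapply (σ ⇒ τ) eq))) ⟩
  rename r′ (unapply (σ ⇒ τ) eq) · (applyTo · weaken f) · v₀
    ≈⟨ unapply-β σ τ eq r′ _ _ ⟩
  rename r′ (unapply τ eq) · ƛ (applyTo · weaken (weaken f) · ƛ (v₁ · (v₀ · v₂)))
    ≈⟨ ·-congˡ (ƛ-cong (applyTo-β _ _)) ⟩
  rename r′ (unapply τ eq) · ƛ (ƛ (v₁ · (v₀ · v₂)) · weaken (weaken f))
    ≈⟨ ·-congˡ (ƛ-cong (β _ _)) ⟩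
  rename r′ (unapply τ eq) · ƛ (v₀ · weaken (weaken f · v₀))
    -- A β-expansion folds λk. k (f y) back into an instance of `applyTo`, the form required by the
    -- induction hypothesis.
    ≈⟨ ·-congˡ (=-sym (β _ _)) ⟩
  rename r′ (unapply τ eq) · (applyTo · (weaken f · v₀))
    ≈⟨ unapply-inverse τ eq r′ _ ⟩
  weaken f · v₀ ∎)
  where
  r′ : [] ⊆ σ ∷ F
  r′ x = there (r x)

retract-A4 : ∀ {σ a} → head σ ≡ a → AffineRetract σ ((σ ⇒ ` a) ⇒ ` a)
retract-A4 {σ} eq = record
  { code    = applyTo
  ; decode  = unapply σ eq
  ; affineᶜ = (λ ()) , s≤s z≤n , s≤s z≤n , tt , tt
  ; affineᵈ = unapply-affine σ eq
  ; inverse = unapply-inverse σ eq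
  }

-- Soundness of LPS and of CF

LPS⇒retract : ∀ {σ τ} → σ ⊴LPS τ → AffineRetract σ τ
LPS⇒retract (conv p q d) =
  -- The isomorphism of the sources is traversed backwards, that of the targets forwards.
  retract-trans (proj₂ (∼⇒retracts p)) (retract-trans (LPS⇒retract d) (proj₁ (∼⇒retracts q)))
LPS⇒retract A1       = retract-refl
LPS⇒retract A2       = retract-A2
LPS⇒retract (A4 eq)  = retract-A4 eq
LPS⇒retract (R1 d e) = retract-trans (LPS⇒retract d) (LPS⇒retract e)
LPS⇒retract (R2 d e) = retract-⇒ (LPS⇒retract d) (LPS⇒retract e)

proposition3p2 : (σ τ : Ty) → (σ ⊴CF τ → σ ⊴LPS τ) × (σ ⊴CF τ → σ ⊴¹ τ)
proposition3p2 σ τ = CF⇒LPS , AffineRetract⇒⊴¹ ∘ LPS⇒retract ∘ CF⇒LPS
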